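{- Let $\varphi$ be a quantifier-free formula in the SMT theory of bit-vectors and let $\mathit{cost}$ be a bit-vector variable of width $n$ occurring in $\varphi$, interpreted either as unsigned or as signed (two's complement). Consider the problem of minimizing (resp. maximizing) $\mathit{cost}$ subject to $\varphi$, i.e. finding a model $\mathcal{M}$ of $\varphi$ whose value $\mathcal{M}(\mathit{cost})$ is minimum (resp. maximum) among all models of $\varphi$ with respect to the unsigned order if $\mathit{cost}$ is unsigned and the signed (two's complement) order if $\mathit{cost}$ is signed. Let $\mathit{attr}$ be the attractor of $\mathit{cost}$ and $A=[A[0],\dots,A[n-1]]$ the vector of attractor equalities. Then any model $\mathcal{M}$ of $\varphi$ which lexicographically maximizes $A$ with respect to $\varphi$ is an optimal solution of this problem, i.e. $\mathcal{M}(\mathit{cost})$ is minimum (resp. maximum) among the values of $\mathit{cost}$ in models of $\varphi$.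
   Context: Bits of $\mathit{cost}$ are indexed from the most significant bit $\mathit{cost}[0]$ to the least significant bit $\mathit{cost}[n-1]$. An unsigned $n$-bit vector has value $\sum_{k=0}^{n-1}2^{n-1-k}\,\mathit{cost}[k]\in[0,2^n-1]$; a signed one has value $-2^{n-1}\mathit{cost}[0]+\sum_{k=1}^{n-1}2^{n-1-k}\mathit{cost}[k]\in[-2^{n-1},2^{n-1}-1]$. When minimizing (resp. maximizing), the attractor $\mathit{attr}$ is the smallest (resp. greatest) bit-vector value of the sort of $\mathit{cost}$ (e.g. $[0\dots0]$ for unsigned minimization, $[10\dots0]$ for signed minimization, $[1\dots1]$ for unsigned maximization, $[01\dots1]$ for signed maximization). The vector of attractor equalities is $A$ with $A[k]:=(\mathit{cost}[k]=\mathit{attr}[k])$ for $k\in[0..n-1]$. For an assignment $\tau_n$ to all bits of $\mathit{cost}$ and $i\le n$, $\tau_n|_i$ denotes its restriction to the bits $\mathit{cost}[0],\dots,\mathit{cost}[i-1]$ (viewed as a conjunction of bit literals). An assignment $\tau_n$ to $\mathit{cost}$ lexicographically maximizes $A$ with respect to $\varphi$ iff for every $k\in[0..n-1]$: $\tau_n[k]=\overline{\mathit{attr}[k]}$ (the complement bit) if $\varphi\wedge\tau_n|_k\wedge A[k]$ is unsatisfiable, and $\tau_n[k]=\mathit{attr}[k]$ otherwise. A model $\mathcal{M}$ of $\varphi$ lexicographically maximizes $A$ with respect to $\varphi$ iff its restriction to the bits of $\mathit{cost}$ does. -}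

module Defs where

open import Data.Bool using (Bool; true; _∧_; _∨_; if_then_else_) renaming (not to notᵇ; _xor_ to _⊕_)
open import Data.Bool.Properties using () renaming (_≟_ to _≟ᵇ_)
open import Data.Fin using (Fin; toℕ; fromℕ<; opposite)
open import Data.Fin.Properties using (toℕ≤pred[n]; toℕ<n)
open import Data.Integer using (ℤ; +_; -_) renaming (_+_ to _+ᶻ_; _≤_ to _≤ᶻ_)
open import Data.List using (List; foldr; map; filter; allFin)
open import Data.List.Membership.Propositional using (_∈_)
open import Data.Nat using (ℕ; zero; suc; _+_; _*_; _∸_; _^_; _/_; _%_; _<_; _<?_; _≟_; NonZero)
open import Data.Nat.Properties using (+-monoˡ-≤; ≤-<-trans; m^n≢0)
open import Data.Product using (_×_)
open import Data.Vec as Vec using (Vec; []; _∷_; lookup; tabulate; replicate; zipWith; _++_)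
open import Data.Vec.Properties using (≡-dec)
open import Relation.Binary.PropositionalEquality using (_≡_)
open import Relation.Binary.Definitions using (DecidableEquality)
open import Relation.Nullary using (¬_)
open import Relation.Nullary.Decidable using (⌊_⌋)

private variable
  m n : ℕ

+-nonZeroˡ : (m n : ℕ) .{{_ : NonZero m}} → NonZero (m + n)
+-nonZeroˡ (suc m) n = _

-- The head of the vector is the most significant bit.
BitVec : ℕ → Set
BitVec n = Vec Bool n

bitℕ : Bool → ℕ
bitℕ b = if b then 1 else 0

unsigned : BitVec n → ℕ
unsigned {n} v = Vec.sum (tabulate λ (k : Fin n) → 2 ^ (n ∸ suc (toℕ k)) * bitℕ (lookup v k))

-- Two's complement.  The value at width 0 is junk: sorts have positive width.
signed : BitVec n → ℤ
signed []            = + 0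
signed (_∷_ {n} b v) = - (+ (2 ^ n * bitℕ b)) +ᶻ + unsigned v

-- The n-bit vector whose unsigned value is x modulo 2 ^ n.
fromℕ : (n x : ℕ) → BitVec n
fromℕ n x = tabulate λ k → ⌊ quotient (n ∸ suc (toℕ k)) % 2 ≟ 1 ⌋
  where
  quotient : ℕ → ℕ
  quotient i = _/_ x (2 ^ i) {{m^n≢0 2 i}}

-- Bits j, …, d + j, where, as in SMT-LIB's extract, position 0 is the least
-- significant bit.
slice : (j d : ℕ) → d + j < n → BitVec n → BitVec (suc d)
slice j d d+j<n v = tabulate λ k →
  lookup v (opposite (fromℕ< (≤-<-trans (+-monoˡ-≤ j (toℕ≤pred[n] (opposite k))) d+j<n)))

shiftRight : BitVec n → ℕ → BitVec n
shiftRight {n} v i = fromℕ n (_/_ (unsigned v) (2 ^ i) {{m^n≢0 2 i}})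

-- Division by zero follows SMT-LIB: x / 0 is all ones and x mod 0 is x.
udiv : BitVec n → BitVec n → BitVec n
udiv {n} u v with unsigned v
... | zero  = replicate n true
... | suc d = fromℕ n (unsigned u / suc d)

urem : BitVec n → BitVec n → BitVec n
urem {n} u v with unsigned v
... | zero  = u
... | suc d = fromℕ n (unsigned u % suc d)

data Sort : Set where
  bool : Sort
  bv   : (n : ℕ) .{{_ : NonZero n}} → Sort

Value : Sort → Set
Value bool   = Bool
Value (bv n) = BitVec n

_≟ᵛ_ : ∀ {s} → DecidableEquality (Value s)
_≟ᵛ_ {bool} = _≟ᵇ_
_≟ᵛ_ {bv n} = ≡-dec _≟ᵇ_

-- The symbols are those of SMT-LIB 2.6's theories Core and FixedSizeBitVectors.
-- The others available in QF_BV (bvsub, bvxor, bvule, bvslt, bvsdiv, bvashr,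
-- sign_extend, …) are defined by SMT-LIB as abbreviations over these.

data UnOp : Sort → Sort → Set where
  not         : UnOp bool bool
  bvnot bvneg : .{{_ : NonZero n}} → UnOp (bv n) (bv n)
  -- extract j d _ is SMT-LIB's (_ extract (d + j) j).
  extract     : .{{_ : NonZero n}} (j d : ℕ) → d + j < n → UnOp (bv n) (bv (suc d))

data BinOp : Sort → Sort → Sort → Set where
  and or xor implies                                : BinOp bool bool bool
  eq distinct                                       : ∀ {s} → BinOp s s bool
  concat                                            : .{{_ : NonZero m}} .{{_ : NonZero n}} →
                                                      BinOp (bv m) (bv n) (bv (m + n) {{+-nonZeroˡ m n}})
  bvand bvor bvadd bvmul bvudiv bvurem bvshl bvlshr : .{{_ : NonZero n}} → BinOp (bv n) (bv n) (bv n)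
  bvult                                             : .{{_ : NonZero n}} → BinOp (bv n) (bv n) bool

-- Γ lists the sorts of the declared variables.
data Term (Γ : List Sort) : Sort → Set where
  var     : ∀ {s} → s ∈ Γ → Term Γ s
  literal : ∀ {s} → Value s → Term Γ s
  unary   : ∀ {s t} → UnOp s t → Term Γ s → Term Γ t
  binary  : ∀ {s t u} → BinOp s t u → Term Γ s → Term Γ t → Term Γ u
  ite     : ∀ {s} → Term Γ bool → Term Γ s → Term Γ s → Term Γ s

Formula : List Sort → Set
Formula Γ = Term Γ bool

data _OccursIn_ {Γ s} (x : s ∈ Γ) : ∀ {t} → Term Γ t → Set where
  var     : x OccursIn var x
  unary   : ∀ {t u} {o : UnOp t u} {a} → x OccursIn a → x OccursIn unary o a
  binaryˡ : ∀ {t u v} {o : BinOp t u v} {a b} → x OccursIn a → x OccursIn binary o a b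
  binaryʳ : ∀ {t u v} {o : BinOp t u v} {a b} → x OccursIn b → x OccursIn binary o a b
  iteᶜ    : ∀ {t c} {a b : Term Γ t} → x OccursIn c → x OccursIn ite c a b
  iteˡ    : ∀ {t c} {a b : Term Γ t} → x OccursIn a → x OccursIn ite c a b
  iteʳ    : ∀ {t c} {a b : Term Γ t} → x OccursIn b → x OccursIn ite c a b

⟦_⟧₁ : ∀ {s t} → UnOp s t → Value s → Value t
⟦ not ⟧₁               b = notᵇ b
⟦ bvnot ⟧₁             v = Vec.map notᵇ v
⟦ bvneg {n} ⟧₁         v = fromℕ n (2 ^ n ∸ unsigned v)
⟦ extract j d d+j<n ⟧₁ v = slice j d d+j<n v

⟦_⟧₂ : ∀ {s t u} → BinOp s t u → Value s → Value t → Value u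
⟦ and ⟧₂          a b = a ∧ b
⟦ or ⟧₂           a b = a ∨ b
⟦ xor ⟧₂          a b = a ⊕ b
⟦ implies ⟧₂      a b = notᵇ a ∨ b
⟦ eq {s} ⟧₂       u v = ⌊ _≟ᵛ_ {s} u v ⌋
⟦ distinct {s} ⟧₂ u v = notᵇ ⌊ _≟ᵛ_ {s} u v ⌋
⟦ concat ⟧₂       u v = u ++ v
⟦ bvand ⟧₂        u v = zipWith _∧_ u v
⟦ bvor ⟧₂         u v = zipWith _∨_ u v
⟦ bvadd {n} ⟧₂    u v = fromℕ n (unsigned u + unsigned v)
⟦ bvmul {n} ⟧₂    u v = fromℕ n (unsigned u * unsigned v)
⟦ bvudiv ⟧₂       u v = udiv u v
⟦ bvurem ⟧₂       u v = urem u v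
⟦ bvshl {n} ⟧₂    u v = fromℕ n (unsigned u * 2 ^ unsigned v)
⟦ bvlshr ⟧₂       u v = shiftRight u (unsigned v)
⟦ bvult ⟧₂        u v = ⌊ unsigned u <? unsigned v ⌋

Interpretation : List Sort → Set
Interpretation Γ = ∀ {s} → s ∈ Γ → Value s

eval : ∀ {Γ s} → Interpretation Γ → Term Γ s → Value s
eval M (var x)        = M x
eval M (literal v)    = v
eval M (unary o a)    = ⟦ o ⟧₁ (eval M a)
eval M (binary o a b) = ⟦ o ⟧₂ (eval M a) (eval M b)
eval M (ite c a b)    = if eval M c then eval M a else eval M b

_⊨_ : ∀ {Γ} → Interpretation Γ → Formula Γ → Set
M ⊨ φ = eval M φ ≡ true

Unsatisfiable : ∀ {Γ} → Formula Γ → Set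
Unsatisfiable {Γ} φ = (M : Interpretation Γ) → ¬ (M ⊨ φ)

data Signedness : Set where
  isUnsigned isSigned : Signedness

data Goal : Set where
  minimize maximize : Goal

value : Signedness → BitVec n → ℤ
value isUnsigned v = + unsigned v
value isSigned   v = signed v

AtLeastAsGood : Goal → Signedness → BitVec n → BitVec n → Set
AtLeastAsGood minimize σ u v = value σ u ≤ᶻ value σ v
AtLeastAsGood maximize σ u v = value σ v ≤ᶻ value σ u

IsAttractor : Goal → Signedness → BitVec n → Set
IsAttractor {n} g σ attr = (v : BitVec n) → AtLeastAsGood g σ attr v

module _ {Γ : List Sort} where

  infixr 6 _∧ᶠ_
  _∧ᶠ_ : Formula Γ → Formula Γ → Formula Γ
  φ ∧ᶠ ψ = binary and φ ψ

  ⋀ : List (Formula Γ) → Formula Γ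
  ⋀ = foldr _∧ᶠ_ (literal true)

  module _ {n : ℕ} .{{_ : NonZero n}} (cost : bv n ∈ Γ) where

    IsOptimal : Goal → Signedness → Formula Γ → Interpretation Γ → Set
    IsOptimal g σ φ M =
      M ⊨ φ × ((M′ : Interpretation Γ) → M′ ⊨ φ → AtLeastAsGood g σ (M cost) (M′ cost))

    -- Here k counts from the most significant bit, hence opposite.
    bit : Fin n → Term Γ (bv 1)
    bit k = unary (extract (toℕ (opposite k)) 0 (toℕ<n (opposite k))) (var cost)

    bit[_]≐_ : Fin n → Bool → Formula Γ
    bit[ k ]≐ b = binary eq (bit k) (literal (b ∷ []))

    attractorEqualities : BitVec n → Fin n → Formula Γ
    attractorEqualities attr k = bit[ k ]≐ lookup attr k

    restrict : BitVec n → ℕ → Formula Γ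
    restrict τ i = ⋀ (map (λ j → bit[ j ]≐ lookup τ j) (filter (λ j → toℕ j <? i) (allFin n)))

    AssignmentLexMaximizes : BitVec n → Formula Γ → BitVec n → Set
    AssignmentLexMaximizes attr φ τ = (k : Fin n) →
      (Unsatisfiable (query k)   → lookup τ k ≡ notᵇ (lookup attr k)) ×
      (¬ Unsatisfiable (query k) → lookup τ k ≡ lookup attr k)
      where
      query : Fin n → Formula Γ
      query k = φ ∧ᶠ restrict τ (toℕ k) ∧ᶠ attractorEqualities attr k

    LexMaximizes : BitVec n → Formula Γ → Interpretation Γ → Set
    LexMaximizes attr φ M = AssignmentLexMaximizes attr φ (M cost)

{-# OPTIONS --safe #-}
-- Call u closer to c than v when u agrees with c, and v does not, at the first
-- bit where u and v differ.  A lexicographically maximizing M is never farther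
-- from the attractor than another model M′: at the first bit k where they
-- differ, if M′ agreed with the attractor, M′ would witness the satisfiability
-- of the query for k, so M would agree with it too.  And since bit k outweighs
-- all the less significant bits together, the closer of two vectors has the
-- strictly better value; this also shows that the attractor is unique.
module Submission where

open import Data.Bool using (Bool; true; false; _∧_) renaming (not to notᵇ)
open import Data.Bool.Properties using (¬-not; not-involutive) renaming (_≟_ to _≟ᵇ_)
open import Data.Fin using (Fin; zero; suc; toℕ; opposite)
open import Data.Fin.Properties using (fromℕ<-toℕ; opposite-involutive)
open import Data.Integer using (+_; -_; +<+; +≤+) renaming (_+_ to _+ᶻ_; _<_ to _<ᶻ_)
import Data.Integer.Properties as ℤ
open import Data.List using (List; []; _∷_; allFin)
open import Data.List.Membership.Propositional using (_∈_)
open import Data.List.Relation.Unary.All as All using (All; []; _∷_)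
open import Data.List.Relation.Unary.All.Properties using (all-filter; map⁺)
open import Data.Nat using (ℕ; suc; _*_; _^_; _<_; _<?_; NonZero; z≤n; s≤s)
open import Data.Nat.Properties
  using (+-monoʳ-<; m≤m+n; <-≤-trans; *-identityʳ; *-zeroʳ; +-identityʳ)
open import Data.Product using (_×_; _,_; proj₁; proj₂)
open import Data.Sum using (_⊎_; inj₁; inj₂)
import Data.Vec as Vec
open import Data.Vec using ([]; _∷_; lookup; replicate)
open import Relation.Binary.PropositionalEquality using (_≡_; refl; sym; trans; cong; cong₂; subst)
open import Relation.Nullary using (¬_; yes; no; contradiction)
open import Relation.Nullary.Decidable using (dec-true; isYes≗does)
open import Defs

private variable
  n : ℕ
  Γ : List Sort

data Closer : BitVec n → BitVec n → BitVec n → Set where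
  here  : ∀ {a} {c u v : BitVec n} → Closer (a ∷ c) (a ∷ u) (notᵇ a ∷ v)
  there : ∀ {a b} {c u v : BitVec n} → Closer c u v → Closer (a ∷ c) (b ∷ u) (b ∷ v)

-- At the first difference exactly one of the two vectors carries the bit of `c`; the other carries
-- its complement. This reduces maximization to minimization.
closer-complement : {c u v : BitVec n} → Closer (Vec.map notᵇ c) u v → Closer c v u
closer-complement {c = a ∷ c} {_ ∷ u} {_ ∷ v} here =
  subst (λ b → Closer (a ∷ c) (b ∷ v) (notᵇ a ∷ u)) (sym (not-involutive a)) here
closer-complement {c = _ ∷ _} (there p) = there (closer-complement p)

-- The hypothesis abstracts lexicographic maximality. Two distinct bits can neither both match nor
-- both miss a third, and at the first difference the hypothesis rules out that `v` is the one
-- matching `c`.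
equal-or-closer : (c u v : BitVec n) →
  (∀ k → (∀ j → toℕ j < toℕ k → lookup u j ≡ lookup v j) →
         lookup v k ≡ lookup c k → lookup u k ≡ lookup c k) →
  u ≡ v ⊎ Closer c u v
equal-or-closer [] [] [] _ = inj₁ refl
equal-or-closer (a ∷ c) (b ∷ u) (b′ ∷ v) h with b ≟ᵇ b′
... | yes refl with equal-or-closer c u v
                      (λ k agree → h (suc k) λ { zero _ → refl ; (suc j) (s≤s j<k) → agree j j<k })
...   | inj₁ refl = inj₁ refl
...   | inj₂ p    = inj₂ (there p)
equal-or-closer (a ∷ c) (b ∷ u) (b′ ∷ v) h | no b≢b′ with b′ ≟ᵇ a
... | yes refl = contradiction (h zero (λ _ ()) refl) b≢b′
... | no b′≢a with b ≟ᵇ a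
...   | yes refl = inj₂ (subst (λ x → Closer (a ∷ c) (a ∷ u) (x ∷ v)) (sym (¬-not b′≢a)) here)
...   | no b≢a   = contradiction (trans (¬-not b≢a) (sym (¬-not b′≢a))) b≢b′

unsigned<2^n : (v : BitVec n) → unsigned v < 2 ^ n
unsigned<2^n [] = s≤s z≤n
-- `unsigned (b ∷ v)` computes to `2 ^ n * bitℕ b + unsigned v`; the rewrite simplifies the leading
-- product.
unsigned<2^n {suc n} (false ∷ v) rewrite *-zeroʳ (2 ^ n) =
  <-≤-trans (unsigned<2^n v) (m≤m+n (2 ^ n) _)
unsigned<2^n {suc n} (true ∷ v) rewrite *-identityʳ (2 ^ n) | +-identityʳ (2 ^ n) =
  +-monoʳ-< (2 ^ n) (unsigned<2^n v)

closer⇒unsigned-< : {u v : BitVec n} → Closer (replicate n false) u v → unsigned u < unsigned v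
closer⇒unsigned-< {suc n} {_ ∷ u} {_ ∷ v} here
  rewrite *-zeroʳ (2 ^ n) | *-identityʳ (2 ^ n) = <-≤-trans (unsigned<2^n u) (m≤m+n (2 ^ n) _)
closer⇒unsigned-< {suc n} {b ∷ _} (there p) = +-monoʳ-< (2 ^ n * bitℕ b) (closer⇒unsigned-< p)

-- The sign bit alone has negative weight, so the signed vector sets it and clears the rest.
least : (n : ℕ) → Signedness → BitVec n
least n       isUnsigned = replicate n false
least 0       isSigned   = []
least (suc n) isSigned   = true ∷ replicate n false

closer⇒value-< : (σ : Signedness) {u v : BitVec n} → Closer (least n σ) u v → value σ u <ᶻ value σ v
closer⇒value-< isUnsigned p = +<+ (closer⇒unsigned-< p)
-- Only the first vector has its sign bit set, so 0 separates the two values.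
closer⇒value-< {suc n} isSigned {_ ∷ u} {_ ∷ v} here
  rewrite *-zeroʳ (2 ^ n) | *-identityʳ (2 ^ n) = begin-strict
    - (+ (2 ^ n)) +ᶻ + unsigned u  <⟨ ℤ.+-monoʳ-< (- (+ (2 ^ n))) (+<+ (unsigned<2^n u)) ⟩
    - (+ (2 ^ n)) +ᶻ + (2 ^ n)     ≡⟨ ℤ.+-inverseˡ (+ (2 ^ n)) ⟩
    + 0                            ≤⟨ +≤+ z≤n ⟩
    + unsigned v                   ≡⟨ ℤ.+-identityˡ (+ unsigned v) ⟨
    + 0 +ᶻ + unsigned v            ∎
  where open ℤ.≤-Reasoning
closer⇒value-< {suc n} isSigned {b ∷ _} (there p) =
  ℤ.+-monoʳ-< (- (+ (2 ^ n * bitℕ b))) (+<+ (closer⇒unsigned-< p))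

attractor : Goal → (n : ℕ) → Signedness → BitVec n
attractor minimize n σ = least n σ
attractor maximize n σ = Vec.map notᵇ (least n σ)

-- The first half gives optimality; the second, strictness, excludes a second attractor.
closer⇒better : (g : Goal) (σ : Signedness) {u v : BitVec n} → Closer (attractor g n σ) u v →
  AtLeastAsGood g σ u v × ¬ AtLeastAsGood g σ v u
closer⇒better minimize σ p = ℤ.<⇒≤ u<v , ℤ.<⇒≱ u<v
  where u<v = closer⇒value-< σ p
closer⇒better maximize σ p = ℤ.<⇒≤ v<u , ℤ.<⇒≱ v<u
  where v<u = closer⇒value-< σ (closer-complement p)

attractor-unique : (g : Goal) (σ : Signedness) {attr : BitVec n} → IsAttractor g σ attr →
  attractor g n σ ≡ attr
attractor-unique {n} g σ {attr} best
  -- The first vector is the target itself, so it matches the target at every bit.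
  with equal-or-closer (attractor g n σ) (attractor g n σ) attr (λ _ _ _ → refl)
... | inj₁ a≡attr = a≡attr
... | inj₂ p      = contradiction (best _) (proj₂ (closer⇒better g σ p))

AtLeastAsGood-refl : (g : Goal) (σ : Signedness) (u : BitVec n) → AtLeastAsGood g σ u u
AtLeastAsGood-refl minimize σ u = ℤ.≤-refl
AtLeastAsGood-refl maximize σ u = ℤ.≤-refl

⊨-∧ : (M : Interpretation Γ) (φ ψ : Formula Γ) → M ⊨ φ → M ⊨ ψ → M ⊨ (φ ∧ᶠ ψ)
⊨-∧ M φ ψ p q = cong₂ _∧_ p q

⊨-⋀ : (M : Interpretation Γ) {φs : List (Formula Γ)} → All (M ⊨_) φs → M ⊨ ⋀ φs
⊨-⋀ M []                  = refl
⊨-⋀ M (_∷_ {φ} {φs} p ps) = ⊨-∧ M φ (⋀ φs) p (⊨-⋀ M ps)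

module _ .{{_ : NonZero n}} (cost : bv n ∈ Γ) (M : Interpretation Γ) where

  -- `bit` converts the index to a position counted from the least significant bit and `slice`
  -- converts it back; the two reversals cancel.
  eval-bit : (k : Fin n) → eval M (bit cost k) ≡ lookup (M cost) k ∷ []
  eval-bit k = cong (λ j → lookup (M cost) j ∷ [])
    (trans (cong opposite (fromℕ<-toℕ (opposite k) _)) (opposite-involutive k))

  ⊨-bit≐ : (k : Fin n) {b : Bool} → lookup (M cost) k ≡ b → M ⊨ (bit[_]≐_ cost k b)
  ⊨-bit≐ k {b} b-at-k = trans (isYes≗does same?) (dec-true same? (trans (eval-bit k) (cong (_∷ []) b-at-k)))
    where same? = _≟ᵛ_ {bv 1} (eval M (bit cost k)) (b ∷ [])

  ⊨-restrict : (τ : BitVec n) (i : ℕ) → (∀ j → toℕ j < i → lookup (M cost) j ≡ lookup τ j) →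
    M ⊨ restrict cost τ i
  ⊨-restrict τ i agree =
    ⊨-⋀ M (map⁺ (All.map (λ {j} j<i → ⊨-bit≐ j (agree j j<i)) (all-filter (λ j → toℕ j <? i) (allFin n))))

lexMaximizes⇒equal-or-closer : .{{_ : NonZero n}} (cost : bv n ∈ Γ) (attr : BitVec n) (φ : Formula Γ)
  (M M′ : Interpretation Γ) → LexMaximizes cost attr φ M → M′ ⊨ φ →
  M cost ≡ M′ cost ⊎ Closer attr (M cost) (M′ cost)
lexMaximizes⇒equal-or-closer cost attr φ M M′ lex M′⊨φ =
  equal-or-closer attr (M cost) (M′ cost) λ k agree hit →
    -- `M′` is itself a model of the query at `k`: it shares the earlier bits of `M cost` and, by
    -- `hit`, has the attractor's bit at `k`.
    proj₂ (lex k) λ unsat → unsat M′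
      (⊨-∧ M′ φ (restrict cost (M cost) (toℕ k) ∧ᶠ attractorEqualities cost attr k) M′⊨φ
        (⊨-∧ M′ (restrict cost (M cost) (toℕ k)) (attractorEqualities cost attr k)
          (⊨-restrict cost M′ (M cost) (toℕ k) (λ j j<k → sym (agree j j<k)))
          (⊨-bit≐ cost M′ k hit)))

theorem1 : (Γ : List Sort) (n : ℕ) .{{_ : NonZero n}} (φ : Formula Γ) (cost : bv n ∈ Γ) →
    cost OccursIn φ →
    (g : Goal) (σ : Signedness) (attr : BitVec n) → IsAttractor g σ attr →
    (M : Interpretation Γ) → M ⊨ φ → LexMaximizes cost attr φ M →
    IsOptimal cost g σ φ M
theorem1 Γ n φ cost _ g σ attr best M M⊨φ lex = M⊨φ , optimal
  where
  optimal : (M′ : Interpretation Γ) → M′ ⊨ φ → AtLeastAsGood g σ (M cost) (M′ cost)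
  optimal M′ M′⊨φ with lexMaximizes⇒equal-or-closer cost attr φ M M′ lex M′⊨φ
  ... | inj₁ same = subst (AtLeastAsGood g σ (M cost)) same (AtLeastAsGood-refl g σ (M cost))
  -- `p` concerns the given `attr`, whereas values are compared through the explicit attractor;
  -- uniqueness identifies the two.
  ... | inj₂ p    = proj₁ (closer⇒better g σ
                    (subst (λ c → Closer c (M cost) (M′ cost)) (sym (attractor-unique g σ best)) p))
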